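{- Let $W$ be a finite set and let $H_1,\dots,H_r$ be graphs on the same vertex set $W$. Then \[ \mathrm{cc}\Bigl(\bigcup_{j=1}^r H_j\Bigr)=\bigvee_{j=1}^r \mathrm{cc}(H_j). \] In particular, $\bigcup_{j}H_j$ is connected if and only if $\bigvee_j\mathrm{cc}(H_j)=\mathbf 1_W$.
   Context: $\mathrm{Part}(W)$ is the set of partitions of the finite set $W$, ordered by refinement ($\pi\preceq\sigma$ iff every block of $\pi$ is contained in a block of $\sigma$). The join of a family is the finest partition coarser than all its members (equivalently, the transitive closure of the union of the corresponding equivalence relations); the join of the empty family is the discrete partition. $\mathbf 1_W=\{W\}$ is the one-block partition. For a graph $H$ on vertex set $W$ (isolated vertices allowed), $\mathrm{cc}(H)\in\mathrm{Part}(W)$ is the partition of $W$ into connected components. The union of graphs on $W$ has vertex set $W$ and the union of the edge sets. -}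

module Defs where

open import Data.Fin using (Fin)
open import Data.Fin.Properties using (any?; _≟_)
open import Data.Fin.Subset using (Subset; _∈_; _⊆_; ⊤; Nonempty)
open import Data.Fin.Subset.Properties using (_∈?_; ⊆-antisym)
open import Data.List using (List; []; _∷_; allFin)
open import Data.List.Membership.Propositional using () renaming (_∈_ to _∈ˡ_)
open import Data.List.Membership.Propositional.Properties using (∈-allFin)
open import Data.List.Relation.Unary.Any using (here; there)
open import Data.Nat using (ℕ)
open import Data.Product using (∃; _×_; _,_)
open import Data.Sum using (_⊎_; inj₁; inj₂)
open import Data.Vec using (tabulate)
open import Data.Vec.Properties using (lookup∘tabulate; lookup⇒[]=; []=⇒lookup)
open import Function using (_⇔_; mk⇔; Equivalence)
open import Level using (0ℓ; suc)
open import Relation.Binary using (Rel; Symmetric; Irreflexive; IsEquivalence)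
  renaming (Decidable to Decidable₂)
open import Relation.Binary.Construct.Closure.ReflexiveTransitive
  using (Star; ε; _◅_; _◅◅_; reverse; return)
open import Relation.Binary.PropositionalEquality using (_≡_; refl; sym; trans; subst)
open import Relation.Nullary using (yes; does; _×-dec_; _⊎-dec_)
open import Relation.Nullary.Decidable using (map′; dec-true)
open import Relation.Unary using (Pred; _≐_; ｛_｝) renaming (Decidable to Decidable₁)

private
  variable
    n r : ℕ

-- The finite set W is Fin n throughout; a block is a Subset n, and a partition
-- is given by its set of blocks.
record Partition (n : ℕ) : Set (suc 0ℓ) where
  field
    Block    : Pred (Subset n) 0ℓ
    nonempty : ∀ {B} → Block B → Nonempty B
    cover    : ∀ x → ∃ λ B → Block B × x ∈ B
    disjoint : ∀ {B C x} → Block B → Block C → x ∈ B → x ∈ C → B ≡ C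

open Partition public

infix 4 _≈_ _≼_

_≈_ : Rel (Partition n) 0ℓ
π ≈ σ = Block π ≐ Block σ

_≼_ : Rel (Partition n) 0ℓ
π ≼ σ = ∀ {B} → Block π B → ∃ λ C → Block σ C × B ⊆ C

-- The set of blocks {W}.  It is not typed as a Partition because for n = 0 its
-- only member is empty.
𝟏 : (n : ℕ) → Pred (Subset n) 0ℓ
𝟏 n = ｛ ⊤ ｝

SameBlock : Partition n → Rel (Fin n) 0ℓ
SameBlock π x y = ∃ λ B → Block π B × x ∈ B × y ∈ B

sameBlock? : (π : Partition n) → Decidable₂ (SameBlock π)
sameBlock? π x y with cover π x
... | B , bB , x∈B = map′ (λ y∈B → B , bB , x∈B , y∈B)
  (λ (C , bC , x∈C , y∈C) → subst (y ∈_) (disjoint π bC bB x∈C x∈B) y∈C)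
  (y ∈? B)

sameBlock-sym : (π : Partition n) → Symmetric (SameBlock π)
sameBlock-sym π (B , bB , x∈B , y∈B) = B , bB , y∈B , x∈B

record Graph (n : ℕ) : Set (suc 0ℓ) where
  field
    Adj        : Rel (Fin n) 0ℓ
    adj?       : Decidable₂ Adj
    adj-sym    : Symmetric Adj
    adj-irrefl : Irreflexive _≡_ Adj

open Graph public

⋃ : (Fin r → Graph n) → Graph n
⋃ H = record
  { Adj        = λ x y → ∃ λ j → Adj (H j) x y
  ; adj?       = λ x y → any? (λ j → adj? (H j) x y)
  ; adj-sym    = λ (j , e) → j , adj-sym (H j) e
  ; adj-irrefl = λ x≡y (j , e) → adj-irrefl (H j) x≡y e
  }

Walk : Graph n → Rel (Fin n) 0ℓ
Walk H = Star (Adj H)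

-- Connected graphs are nonempty (the factor Fin n): for n = 0 there are no
-- components, and the set of components is not {W}.
Connected : Graph n → Set
Connected {n} H = Fin n × (∀ u v → Walk H u v)

-- Star R is decidable on Fin n: Via R vs x y says that y can be reached from x
-- through intermediate vertices in vs (Warshall's recursion).
module _ (R : Rel (Fin n) 0ℓ) where

  Via : List (Fin n) → Rel (Fin n) 0ℓ
  Via []       x y = x ≡ y ⊎ R x y
  Via (v ∷ vs) x y = Via vs x y ⊎ (Via vs x v × Via vs v y)

  via? : Decidable₂ R → ∀ vs → Decidable₂ (Via vs)
  via? R? []       x y = (x ≟ y) ⊎-dec R? x y
  via? R? (v ∷ vs) x y = via? R? vs x y ⊎-dec (via? R? vs x v ×-dec via? R? vs v y)

  via-base : ∀ vs {x y} → x ≡ y ⊎ R x y → Via vs x y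
  via-base []       p = p
  via-base (v ∷ vs) p = inj₁ (via-base vs p)

  via-trans : ∀ {vs x y z} → z ∈ˡ vs → Via vs x z → Via vs z y → Via vs x y
  via-trans (here refl) p q = inj₂ (fromˡ p , fromʳ q)
    where
    fromˡ : ∀ {A B : Set} → A ⊎ (A × B) → A
    fromˡ (inj₁ a)       = a
    fromˡ (inj₂ (a , _)) = a
    fromʳ : ∀ {A B : Set} → B ⊎ (A × B) → B
    fromʳ (inj₁ b)       = b
    fromʳ (inj₂ (_ , b)) = b
  via-trans (there z∈) (inj₁ p)         (inj₁ q)         = inj₁ (via-trans z∈ p q)
  via-trans (there z∈) (inj₁ p)         (inj₂ (q₁ , q₂)) = inj₂ (via-trans z∈ p q₁ , q₂)
  via-trans (there z∈) (inj₂ (p₁ , p₂)) (inj₁ q)         = inj₂ (p₁ , via-trans z∈ p₂ q)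
  via-trans (there z∈) (inj₂ (p₁ , p₂)) (inj₂ (q₁ , q₂)) = inj₂ (p₁ , q₂)

  via⇒star : ∀ vs {x y} → Via vs x y → Star R x y
  via⇒star []       (inj₁ refl)    = ε
  via⇒star []       (inj₂ e)       = return e
  via⇒star (v ∷ vs) (inj₁ p)       = via⇒star vs p
  via⇒star (v ∷ vs) (inj₂ (p , q)) = via⇒star vs p ◅◅ via⇒star vs q

  star⇒via : ∀ {x y} → Star R x y → Via (allFin n) x y
  star⇒via ε        = via-base (allFin n) (inj₁ refl)
  star⇒via (e ◅ es) =
    via-trans (∈-allFin _) (via-base (allFin n) (inj₂ e)) (star⇒via es)

  star? : Decidable₂ R → Decidable₂ (Star R)
  star? R? x y = map′ (via⇒star (allFin n)) star⇒via (via? R? (allFin n) x y)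

module _ {P : Pred (Fin n) 0ℓ} (P? : Decidable₁ P) where

  subset : Subset n
  subset = tabulate (λ x → does (P? x))

  ∈-subset : ∀ x → x ∈ subset ⇔ P x
  ∈-subset x = mk⇔ to′ from′
    where
    to′ : x ∈ subset → P x
    to′ x∈ with P? x | trans (sym (lookup∘tabulate (λ y → does (P? y)) x)) ([]=⇒lookup x∈)
    ... | yes p | _ = p
    from′ : P x → x ∈ subset
    from′ p = lookup⇒[]= x subset
      (trans (lookup∘tabulate (λ y → does (P? y)) x) (dec-true (P? x) p))

IsClassOf : Rel (Fin n) 0ℓ → Fin n → Subset n → Set
IsClassOf R x B = ∀ y → y ∈ B ⇔ R x y

classes : (R : Rel (Fin n) 0ℓ) → Decidable₂ R → IsEquivalence R → Partition n
classes R R? eq = record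
  { Block    = λ B → ∃ λ x → IsClassOf R x B
  ; nonempty = λ (x , h) → x , from (h x) E.refl
  ; cover    = λ x → subset (R? x) , (x , ∈-subset (R? x)) , from (∈-subset (R? x) x) E.refl
  ; disjoint = λ bB bC x∈B x∈C → ⊆-antisym (incl bB bC x∈B x∈C) (incl bC bB x∈C x∈B)
  }
  where
  module E = IsEquivalence eq
  open Equivalence
  incl : ∀ {B C x} → (∃ λ b → IsClassOf R b B) → (∃ λ c → IsClassOf R c C) →
         x ∈ B → x ∈ C → B ⊆ C
  incl {x = x} (b , hB) (c , hC) x∈B x∈C {y} y∈B =
    from (hC y) (E.trans (to (hC x) x∈C) (E.trans (E.sym (to (hB x) x∈B)) (to (hB y) y∈B)))

star-isEquivalence : {R : Rel (Fin n) 0ℓ} → Symmetric R → IsEquivalence (Star R)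
star-isEquivalence R-sym = record { refl = ε ; sym = reverse R-sym ; trans = _◅◅_ }

cc : Graph n → Partition n
cc H = classes (Walk H) (star? (Adj H) (adj? H)) (star-isEquivalence (adj-sym H))

IsJoin : (Fin r → Partition n) → Partition n → Set₁
IsJoin π σ = (∀ j → π j ≼ σ) × (∀ τ → (∀ j → π j ≼ τ) → σ ≼ τ)

SomeSameBlock : (Fin r → Partition n) → Rel (Fin n) 0ℓ
SomeSameBlock π x y = ∃ λ j → SameBlock (π j) x y

⋁ : (Fin r → Partition n) → Partition n
⋁ π = classes (Star (SomeSameBlock π))
  (star? (SomeSameBlock π) (λ x y → any? (λ j → sameBlock? (π j) x y)))
  (star-isEquivalence (λ (j , s) → j , sameBlock-sym (π j) s))

-- ⋁ π is the finest partition coarser than every π j.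
⋁-isJoin : (π : Fin r → Partition n) → IsJoin π (⋁ π)
⋁-isJoin {n = n} π = upper , least
  where
  open Equivalence
  upper : ∀ j → π j ≼ ⋁ π
  upper j {B} bB =
    let x , x∈B       = nonempty (π j) bB
        C , (c , hC) , x∈C = cover (⋁ π) x
    in C , (c , hC) , λ {y} y∈B →
         from (hC y) (to (hC x) x∈C ◅◅ return (j , B , bB , x∈B , y∈B))
  least : ∀ τ → (∀ j → π j ≼ τ) → ⋁ π ≼ τ
  least τ ub {B} (x , hB) =
    let C , bC , x∈C = cover τ x
    in C , bC , λ {y} y∈B → stay bC x∈C (to (hB y) y∈B)
    where
    stay : ∀ {C y z} → Block τ C → y ∈ C → Star (SomeSameBlock π) y z → z ∈ C
    stay bC y∈C ε = y∈C
    stay bC y∈C ((j , D , bD , y∈D , w∈D) ◅ es) =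
      let E , bE , D⊆E = ub j bD
      in stay bC (subst (_ ∈_) (disjoint τ bE bC (D⊆E y∈D) y∈C) (D⊆E w∈D)) es

{-# OPTIONS --safe #-}
module Submission where

open import Defs
open import Data.Nat using (ℕ)
open import Data.Fin using (Fin)
open import Data.Fin.Subset using (⊤)
open import Data.Fin.Subset.Properties using (∈⊤; ⊆⊤; ⊆-antisym)
open import Data.Product using (_×_; _,_; proj₁)
open import Function using (_⇔_; mk⇔; Equivalence; _∘_)
open import Relation.Binary using (_⇒_)
open import Relation.Binary.Construct.Closure.ReflexiveTransitive
  using (Star; _◅◅_; reverse; map; concat; return)
open import Relation.Binary.PropositionalEquality using (refl)
open import Relation.Unary using (_≐_)
open import Relation.Unary.Properties using (≐-sym; ≐-trans)

open Equivalence

private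
  variable
    n r : ℕ

-- Both partitions consist of the classes of a reflexive-transitive closure: of adjacency in the
-- union, and of lying in a common component of some `H j`. An edge of the union is one link of the
-- second kind, and such a link is a walk inside a single `H j`, so the closures coincide.
-- Connectedness then transfers through `connected⇔cc≐𝟏`.

sameBlock-cc⇒walk : (H : Graph n) → SameBlock (cc H) ⇒ Walk H
sameBlock-cc⇒walk H (_ , (_ , h) , x∈B , y∈B) =
  -- The walk goes through the representative of the block.
  reverse (adj-sym H) (to (h _) x∈B) ◅◅ to (h _) y∈B

walk⇒sameBlock-cc : (H : Graph n) → Walk H ⇒ SameBlock (cc H)
walk⇒sameBlock-cc H {x} {y} w =
  let B , (b , h) , x∈B = cover (cc H) x
  in B , (b , h) , x∈B , from (h y) (to (h x) x∈B ◅◅ w)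

connected⇔cc≐𝟏 : (H : Graph n) → Connected H ⇔ (Block (cc H) ≐ 𝟏 n)
connected⇔cc≐𝟏 {n} H = mk⇔ connected⇒ ⇒connected
  where
  connected⇒ : Connected H → Block (cc H) ≐ 𝟏 n
  connected⇒ (u , walk) =
      (λ (x , h) → ⊆-antisym (λ {y} _ → from (h y) (walk x y)) ⊆⊤)
    , (λ { refl → u , λ y → mk⇔ (λ _ → walk u y) (λ _ → ∈⊤) })

  ⇒connected : Block (cc H) ≐ 𝟏 n → Connected H
  ⇒connected (_ , 𝟏⊆) =
    let ⊤-block = 𝟏⊆ refl
    -- The representative of the block `⊤` is the vertex that `Connected` demands.
    in proj₁ ⊤-block , λ _ _ → sameBlock-cc⇒walk H (⊤ , ⊤-block , ∈⊤ , ∈⊤)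

cc-⋃ : (H : Fin r → Graph n) → cc (⋃ H) ≈ ⋁ (λ j → cc (H j))
cc-⋃ H =
    -- The two closures agree, so a block keeps its representative `x`.
    (λ (x , h) → x , λ y → mk⇔ (walk⇒chain ∘ to (h y)) (from (h y) ∘ chain⇒walk))
  , (λ (x , h) → x , λ y → mk⇔ (chain⇒walk ∘ to (h y)) (from (h y) ∘ walk⇒chain))
  where
  walk⇒chain : Walk (⋃ H) ⇒ Star (SomeSameBlock (λ j → cc (H j)))
  walk⇒chain = map λ (j , e) → j , walk⇒sameBlock-cc (H j) (return e)

  chain⇒walk : Star (SomeSameBlock (λ j → cc (H j))) ⇒ Walk (⋃ H)
  -- Each link expands to a walk in `H j`, its edges tagged by `j`; `concat` joins these walks.
  chain⇒walk = concat ∘ map λ (j , s) → map (j ,_) (sameBlock-cc⇒walk (H j) s)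

lemma2p1 : ∀ (n r : ℕ) (H : Fin r → Graph n) →
    (cc (⋃ H) ≈ ⋁ (λ j → cc (H j))) ×
    (Connected (⋃ H) ⇔ (Block (⋁ (λ j → cc (H j))) ≐ 𝟏 n))
lemma2p1 n r H = cc-⋃ H , mk⇔
  (≐-trans (≐-sym (cc-⋃ H)) ∘ to (connected⇔cc≐𝟏 (⋃ H)))
  (from (connected⇔cc≐𝟏 (⋃ H)) ∘ ≐-trans (cc-⋃ H))
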